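{- Let $p>3$ be a prime, let $G$ be the additive group $(\mathbb{Z}/p\mathbb{Z})^2$, and let $S_1=\{(x,x^3): x\in\mathbb{Z}/p\mathbb{Z}\}\subseteq G$. Then the cop number of the undirected Cayley graph $\mathrm{Cay}(G,S_1)$ is exactly $\left\lceil \tfrac12 p\right\rceil=\left\lceil \tfrac12\sqrt{|G|}\right\rceil$.
   Context: Cops and robbers is played on a finite connected graph. First each cop chooses a starting vertex, then the robber chooses a starting vertex. Then cop turns and robber turns alternate, starting with a cop turn. On a cop turn each cop moves to a neighbouring vertex or stays where it is; on a robber turn the robber does likewise. Several cops may share a vertex, and all players have full information. The cops win if at some point a cop shares a vertex with the robber; the robber wins if this never happens. The cop number is the minimum number of cops for which the cops have a winning strategy. $\mathrm{Cay}(G,S_1)$ is the graph with vertex set $G$ in which $u,v$ are adjacent iff $v-u\in S_1$; since $S_1=-S_1$ it is regarded as undirected. Here $0_G\in S_1$ is allowed: choosing the move $0_G$ simply means staying in place, so the game is the same as on the graph with connection set $S_1\setminus\{0_G\}$. The set $S_1$ generates $G$. -}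

module Defs where

open import Level using (Level; 0ℓ; _⊔_)
open import Algebra.Bundles using (Group; AbelianGroup; CommutativeRing)
open import Algebra.Construct.DirectProduct using (abelianGroup)
import Algebra.Properties.AbelianGroup as AbelianGroupProperties
import Algebra.Properties.Ring as RingProperties
import Algebra.Properties.Semiring.Exp as Exp
open import Data.Fin.Base using (Fin; toℕ)
open import Data.Fin.Properties using (toℕ-injective; toℕ-fromℕ<; toℕ<n)
open import Data.List.NonEmpty using (List⁺; [_]; _∷⁺_; head)
open import Data.Nat.Base using (ℕ; zero; suc; _+_; _*_; _∸_; _^_; _≤_; NonZero)
open import Data.Nat.DivMod using (_%_; _mod_; m%n<n; m%n%n≡m%n; n%n≡0; m<n⇒m%n≡m; %-distribˡ-+; %-distribˡ-*)
open import Data.Nat.Properties using (+-comm; +-assoc; *-comm; *-assoc; *-identityˡ; *-distribʳ-+; m∸n+n≡m; <⇒≤)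
open import Data.Product.Base using (Σ; ∃; _×_; _,_; proj₁; proj₂)
open import Data.Sum.Base using (_⊎_)
open import Function.Bundles using (Inverse)
open import Relation.Binary.Bundles using (Setoid)
open import Relation.Binary.Core using (Rel)
open import Relation.Binary.Definitions using (Symmetric; _Respects_; _Respects₂_)
import Relation.Binary.PropositionalEquality as ≡
open ≡ using (_≡_; refl; sym; trans; cong; cong₂; module ≡-Reasoning)
open import Relation.Unary using (Pred)

-- Undirected, loops allowed.
record Graph (c ℓ a : Level) : Set (Level.suc (c ⊔ ℓ ⊔ a)) where
  field
    vertices : Setoid c ℓ
  open Setoid vertices public using (_≈_) renaming (Carrier to Vertex)
  field
    Adj      : Rel Vertex a
    Adj-sym  : Symmetric Adj
    Adj-resp : Adj Respects₂ _≈_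

  Step : Rel Vertex (ℓ ⊔ a)
  Step u v = Adj u v ⊎ u ≈ v

module CopsAndRobbers {c ℓ a : Level} (Γ : Graph c ℓ a) where
  open Graph Γ

  Placement : ℕ → Set c
  Placement k = Fin k → Vertex

  -- Positions on the cops' turns so far, the current one first.
  History : ℕ → Set c
  History k = List⁺ (Placement k × Vertex)

  record CopStrategy (k : ℕ) : Set (c ⊔ ℓ ⊔ a) where
    field
      start : Placement k
      move  : History k → Placement k
      legal : ∀ h i → Step (proj₁ (head h) i) (move h i)

  -- Since a cop strategy is deterministic and the robber has full information,
  -- the ways of playing against a fixed strategy are exactly the lazy walks of
  -- the robber, with an arbitrary starting vertex.
  record RobberPlay : Set (c ⊔ ℓ ⊔ a) where
    field
      position : ℕ → Vertex
      legal    : ∀ n → Step (position n) (position (suc n))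

  history : ∀ {k} → CopStrategy k → RobberPlay → ℕ → History k
  history σ ρ zero    = [ CopStrategy.start σ , RobberPlay.position ρ zero ]
  history σ ρ (suc n) =
    (CopStrategy.move σ (history σ ρ n) , RobberPlay.position ρ (suc n)) ∷⁺ history σ ρ n

  Catches : ∀ {k} → Placement k → Vertex → Set ℓ
  Catches C r = ∃ λ i → C i ≈ r

  -- Capture can happen after a robber turn (including the initial placement)
  -- or after a cop turn.
  CapturedAt : ∀ {k} → CopStrategy k → RobberPlay → ℕ → Set ℓ
  CapturedAt σ ρ n =
      Catches (proj₁ (head h)) (proj₂ (head h))
    ⊎ Catches (CopStrategy.move σ h) (proj₂ (head h))
    where h = history σ ρ n

  Winning : ∀ {k} → CopStrategy k → Set (c ⊔ ℓ ⊔ a)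
  Winning σ = ∀ ρ → ∃ λ n → CapturedAt σ ρ n

  CopsWin : ℕ → Set (c ⊔ ℓ ⊔ a)
  CopsWin k = Σ (CopStrategy k) Winning

  CopNumberIs : ℕ → Set (c ⊔ ℓ ⊔ a)
  CopNumberIs n = CopsWin n × (∀ k → CopsWin k → n ≤ k)

open CopsAndRobbers public using (CopNumberIs)

module _ {c ℓ s : Level} (G : AbelianGroup c ℓ) where
  open AbelianGroup G using (Carrier; _≈_; _⁻¹; ∙-cong; ⁻¹-cong; group; setoid)
  open Group group using (_//_)
  open AbelianGroupProperties G using (⁻¹-anti-homo-//)

  Cay : (S : Pred Carrier s) → S Respects _≈_ → (∀ {x} → S x → S (x ⁻¹)) → Graph c ℓ s
  Cay S S-resp S-neg = record
    { vertices = setoid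
    ; Adj      = λ u v → S (v // u)
    ; Adj-sym  = λ {u} {v} p → S-resp (⁻¹-anti-homo-// v u) (S-neg p)
    ; Adj-resp = (λ v≈v′ → S-resp (∙-cong v≈v′ (AbelianGroup.refl G)))
               , (λ u≈u′ → S-resp (∙-cong (AbelianGroup.refl G) (⁻¹-cong u≈u′)))
    }

HasOrder : ∀ {c ℓ} → AbelianGroup c ℓ → ℕ → Set (c ⊔ ℓ)
HasOrder G N = Inverse (AbelianGroup.setoid G) (≡.setoid (Fin N))

-- m = ⌈½√N⌉: m is the least natural number with ½√N ≤ m, i.e. N ≤ (2m)².
IsCeilHalfSqrt : ℕ → ℕ → Set
IsCeilHalfSqrt N m = N ≤ (2 * m) ^ 2 × (∀ k → N ≤ (2 * k) ^ 2 → m ≤ k)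

module Residues (p : ℕ) .{{_ : NonZero p}} where

  infixl 6 _⊕_
  infixl 7 _⊗_

  _⊕_ _⊗_ : Fin p → Fin p → Fin p
  x ⊕ y = (toℕ x + toℕ y) mod p
  x ⊗ y = (toℕ x * toℕ y) mod p

  ⊝_ : Fin p → Fin p
  ⊝ x = (p ∸ toℕ x) mod p

  toℕ-mod : ∀ m → toℕ (m mod p) ≡ m % p
  toℕ-mod m = toℕ-fromℕ< (m%n<n m p)

  mod-cong : ∀ {m n} → m % p ≡ n % p → m mod p ≡ n mod p
  mod-cong {m} {n} eq = toℕ-injective (trans (toℕ-mod m) (trans eq (sym (toℕ-mod n))))

  mod-toℕ : ∀ x → toℕ x mod p ≡ x
  mod-toℕ x = toℕ-injective (trans (toℕ-mod (toℕ x)) (m<n⇒m%n≡m (toℕ<n x)))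

  mod-+ : ∀ m n → (m mod p) ⊕ (n mod p) ≡ (m + n) mod p
  mod-+ m n = mod-cong (trans (cong₂ (λ a b → (a + b) % p) (toℕ-mod m) (toℕ-mod n))
                              (sym (%-distribˡ-+ m n p)))

  mod-* : ∀ m n → (m mod p) ⊗ (n mod p) ≡ (m * n) mod p
  mod-* m n = mod-cong (trans (cong₂ (λ a b → (a * b) % p) (toℕ-mod m) (toℕ-mod n))
                              (sym (%-distribˡ-* m n p)))

  ⊕-comm : ∀ x y → x ⊕ y ≡ y ⊕ x
  ⊕-comm x y = cong (_mod p) (+-comm (toℕ x) (toℕ y))

  ⊗-comm : ∀ x y → x ⊗ y ≡ y ⊗ x
  ⊗-comm x y = cong (_mod p) (*-comm (toℕ x) (toℕ y))

  ⊕-assoc : ∀ x y z → (x ⊕ y) ⊕ z ≡ x ⊕ (y ⊕ z)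
  ⊕-assoc x y z = begin
    (x ⊕ y) ⊕ z                        ≡⟨ cong ((x ⊕ y) ⊕_) (mod-toℕ z) ⟨
    (x ⊕ y) ⊕ (toℕ z mod p)            ≡⟨ mod-+ (toℕ x + toℕ y) (toℕ z) ⟩
    (toℕ x + toℕ y + toℕ z) mod p      ≡⟨ cong (_mod p) (+-assoc (toℕ x) (toℕ y) (toℕ z)) ⟩
    (toℕ x + (toℕ y + toℕ z)) mod p    ≡⟨ mod-+ (toℕ x) (toℕ y + toℕ z) ⟨
    (toℕ x mod p) ⊕ (y ⊕ z)            ≡⟨ cong (_⊕ (y ⊕ z)) (mod-toℕ x) ⟩
    x ⊕ (y ⊕ z)                        ∎
    where open ≡-Reasoning

  ⊗-assoc : ∀ x y z → (x ⊗ y) ⊗ z ≡ x ⊗ (y ⊗ z)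
  ⊗-assoc x y z = begin
    (x ⊗ y) ⊗ z                        ≡⟨ cong ((x ⊗ y) ⊗_) (mod-toℕ z) ⟨
    (x ⊗ y) ⊗ (toℕ z mod p)            ≡⟨ mod-* (toℕ x * toℕ y) (toℕ z) ⟩
    (toℕ x * toℕ y * toℕ z) mod p      ≡⟨ cong (_mod p) (*-assoc (toℕ x) (toℕ y) (toℕ z)) ⟩
    (toℕ x * (toℕ y * toℕ z)) mod p    ≡⟨ mod-* (toℕ x) (toℕ y * toℕ z) ⟨
    (toℕ x mod p) ⊗ (y ⊗ z)            ≡⟨ cong (_⊗ (y ⊗ z)) (mod-toℕ x) ⟩
    x ⊗ (y ⊗ z)                        ∎
    where open ≡-Reasoning

  ⊕-identityˡ : ∀ x → (0 mod p) ⊕ x ≡ x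
  ⊕-identityˡ x = begin
    (0 mod p) ⊕ x                      ≡⟨ cong ((0 mod p) ⊕_) (mod-toℕ x) ⟨
    (0 mod p) ⊕ (toℕ x mod p)          ≡⟨ mod-+ 0 (toℕ x) ⟩
    toℕ x mod p                        ≡⟨ mod-toℕ x ⟩
    x                                  ∎
    where open ≡-Reasoning

  ⊗-identityˡ : ∀ x → (1 mod p) ⊗ x ≡ x
  ⊗-identityˡ x = begin
    (1 mod p) ⊗ x                      ≡⟨ cong ((1 mod p) ⊗_) (mod-toℕ x) ⟨
    (1 mod p) ⊗ (toℕ x mod p)          ≡⟨ mod-* 1 (toℕ x) ⟩
    (1 * toℕ x) mod p                  ≡⟨ cong (_mod p) (*-identityˡ (toℕ x)) ⟩
    toℕ x mod p                        ≡⟨ mod-toℕ x ⟩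
    x                                  ∎
    where open ≡-Reasoning

  ⊝-inverseˡ : ∀ x → (⊝ x) ⊕ x ≡ 0 mod p
  ⊝-inverseˡ x = begin
    (⊝ x) ⊕ x                          ≡⟨ cong ((⊝ x) ⊕_) (mod-toℕ x) ⟨
    (⊝ x) ⊕ (toℕ x mod p)              ≡⟨ mod-+ (p ∸ toℕ x) (toℕ x) ⟩
    (p ∸ toℕ x + toℕ x) mod p          ≡⟨ cong (_mod p) (m∸n+n≡m (<⇒≤ (toℕ<n x))) ⟩
    p mod p                            ≡⟨ mod-cong p%p≡0%p ⟩
    0 mod p                            ∎
    where
    open ≡-Reasoning
    p%p≡0%p : p % p ≡ 0 % p
    p%p≡0%p = trans (sym (m%n%n≡m%n p p)) (cong (_% p) (n%n≡0 p))

  ⊗-distribʳ-⊕ : ∀ x y z → (y ⊕ z) ⊗ x ≡ (y ⊗ x) ⊕ (z ⊗ x)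
  ⊗-distribʳ-⊕ x y z = begin
    (y ⊕ z) ⊗ x                             ≡⟨ cong ((y ⊕ z) ⊗_) (mod-toℕ x) ⟨
    (y ⊕ z) ⊗ (toℕ x mod p)                 ≡⟨ mod-* (toℕ y + toℕ z) (toℕ x) ⟩
    ((toℕ y + toℕ z) * toℕ x) mod p         ≡⟨ cong (_mod p) (*-distribʳ-+ (toℕ x) (toℕ y) (toℕ z)) ⟩
    (toℕ y * toℕ x + toℕ z * toℕ x) mod p   ≡⟨ mod-+ (toℕ y * toℕ x) (toℕ z * toℕ x) ⟨
    (y ⊗ x) ⊕ (z ⊗ x)                       ∎
    where open ≡-Reasoning

  ring : CommutativeRing 0ℓ 0ℓ
  ring = record
    { Carrier = Fin p
    ; _≈_ = _≡_
    ; _+_ = _⊕_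
    ; _*_ = _⊗_
    ; -_  = ⊝_
    ; 0#  = 0 mod p
    ; 1#  = 1 mod p
    ; isCommutativeRing = record
      { isRing = record
        { +-isAbelianGroup = record
          { isGroup = record
            { isMonoid = record
              { isSemigroup = record
                { isMagma = record { isEquivalence = ≡.isEquivalence ; ∙-cong = cong₂ _⊕_ }
                ; assoc   = ⊕-assoc
                }
              ; identity = ⊕-identityˡ , λ x → trans (⊕-comm x (0 mod p)) (⊕-identityˡ x)
              }
            ; inverse = ⊝-inverseˡ , λ x → trans (⊕-comm x (⊝ x)) (⊝-inverseˡ x)
            ; ⁻¹-cong = cong ⊝_
            }
          ; comm = ⊕-comm
          }
        ; *-cong     = cong₂ _⊗_
        ; *-assoc    = ⊗-assoc
        ; *-identity = ⊗-identityˡ , λ x → trans (⊗-comm x (1 mod p)) (⊗-identityˡ x)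
        ; distrib    = (λ x y z → trans (⊗-comm x (y ⊕ z))
                         (trans (⊗-distribʳ-⊕ x y z) (cong₂ _⊕_ (⊗-comm y x) (⊗-comm z x))))
                     , ⊗-distribʳ-⊕
        }
      ; *-comm = ⊗-comm
      }
    }

ℤ/_ℤ : (p : ℕ) → .{{NonZero p}} → CommutativeRing 0ℓ 0ℓ
ℤ/ p ℤ = Residues.ring p

module _ (p : ℕ) .{{_ : NonZero p}} where
  private
    module R = CommutativeRing (ℤ/ p ℤ)
    module RP = RingProperties R.ring
    open Exp R.semiring using () renaming (_^_ to _^ᴿ_)

  ℤ/pℤ² : AbelianGroup 0ℓ 0ℓ
  ℤ/pℤ² = abelianGroup R.+-abelianGroup R.+-abelianGroup

  private
    module G = AbelianGroup ℤ/pℤ²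

  S₁ : Pred G.Carrier 0ℓ
  S₁ v = ∃ λ x → v G.≈ (x , x ^ᴿ 3)

  S₁-resp : S₁ Respects G._≈_
  S₁-resp u≈v (x , u≈) = x , G.trans (G.sym u≈v) u≈

  neg-cube : ∀ x → R.- (x ^ᴿ 3) ≡ (R.- x) ^ᴿ 3
  neg-cube x = begin
    R.- (x R.* (x R.* (x R.* R.1#)))                         ≡⟨ RP.-‿distribˡ-* x _ ⟩
    R.- x R.* (x R.* (x R.* R.1#))                           ≡⟨ cong (R.- x R.*_) (RP.-‿involutive _) ⟨
    R.- x R.* (R.- (R.- (x R.* (x R.* R.1#))))               ≡⟨ cong (λ y → R.- x R.* (R.- y)) (RP.-‿distribˡ-* x _) ⟩
    R.- x R.* (R.- (R.- x R.* (x R.* R.1#)))                 ≡⟨ cong (R.- x R.*_) (RP.-‿distribʳ-* (R.- x) _) ⟩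
    R.- x R.* (R.- x R.* (R.- (x R.* R.1#)))                 ≡⟨ cong (λ y → R.- x R.* (R.- x R.* y)) (RP.-‿distribˡ-* x R.1#) ⟩
    R.- x R.* (R.- x R.* (R.- x R.* R.1#))                   ∎
    where open ≡-Reasoning

  S₁-neg : ∀ {v} → S₁ v → S₁ (v G.⁻¹)
  S₁-neg (x , v≈) =
    (R.- x) , G.trans (G.⁻¹-cong v≈) (refl , neg-cube x)

  CubicCayleyGraph : Graph 0ℓ 0ℓ 0ℓ
  CubicCayleyGraph = Cay ℤ/pℤ² S₁ S₁-resp S₁-neg

{-# OPTIONS --safe #-}
module Submission where

-- Write s x = (x , x³). A cop at c and a robber at r ≠ c differ by d = r − c, and the
-- robber's move x runs into the cop's reach iff d + s x is some s y; since 3 is invertible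
-- this is a nontrivial equation of degree at most 2 in x. Hence each cop spoils at
-- most two of the p moves, and k cops with 2k < p never catch the robber.
--
-- Conversely (Frankl), if the robber plays x and a cop answers y, then d grows by
-- s x − s y. A cop is locked on the moves a and b, with a + b ≠ 0, if d = − n (s a + s b):
-- it answers a by − b and b by − a, so n drops whenever a or b is played, while
-- copying the robber keeps d. To lock a cop on a and b, one needs only that d lies
-- on the line of s a + s b, i.e. that a linear functional λ vanishes at d. A free cop is
-- assigned two moves at which it can change λ d by the same δ ≠ 0: the answers
-- are a common y if λ takes equal values at the two moves, and again the negated
-- other move if the two values do not cancel. Among any three moves some two qualify,
-- so f free cops take care of 2f − 1 moves. Every round uses up some cop's budget,
-- hence finally a cop gets locked (and two moves are disposed of) or the robber is caught.

open import Defs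
open import Data.Nat.Base using (ℕ; _<_; ⌈_/2⌉)
open import Data.Nat.Primality using (Prime; prime⇒nonZero)
open import Data.Product.Base using (_×_; ∃-syntax)

open import Algebra.Bundles using (CommutativeRing)
open import Algebra.Core using (Op₁; Op₂)
open import Algebra.Structures using (IsCommutativeRing)
open import Data.Empty using (⊥; ⊥-elim)
open import Data.Fin.Base using (Fin; zero; suc; toℕ; _↑ˡ_; _↑ʳ_; splitAt; combine; remQuot)
open import Data.Fin.Properties using (any?; toℕ<n; ¬∀⟶∃¬; pigeonhole; splitAt-↑ˡ; splitAt-↑ʳ; combine-remQuot; remQuot-combine) renaming (_≟_ to _≟ᶠ_; <⇒≢ to <⇒≢ᶠ)
import Data.Integer.Base as ℤ
import Data.Integer.Properties as ℤ
open import Data.List.Base using (List; []; _∷_; length; allFin)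
open import Data.List.Membership.Propositional using (_∈_)
open import Data.List.Membership.Propositional.Properties using (∈-allFin)
open import Data.List.NonEmpty using (head; tail; [_]; _∷⁺_)
open import Data.List.Properties using (length-tabulate)
open import Data.List.Relation.Unary.All using ([]; _∷_)
open import Data.List.Relation.Unary.AllPairs using ([]; _∷_)
open import Data.List.Relation.Unary.Any using (here; there)
open import Data.List.Relation.Unary.Unique.Propositional using (Unique)
open import Data.List.Relation.Unary.Unique.Propositional.Properties using (allFin⁺)
open import Data.Maybe.Base using (Maybe; just; nothing)
open import Data.Nat.Base as ℕ using (zero; suc; pred; NonZero; ≢-nonZero; _≤_; z≤n; s≤s; ⌊_/2⌋)
open import Data.Nat.Coprimality using (prime⇒coprime; coprime-Bézout)
open import Data.Nat.DivMod using (_%_; _mod_; m<n⇒m%n≡m; [m+kn]%n≡m%n; m*n%n≡0)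
open import Data.Nat.Divisibility using (divides)
open import Data.Nat.GCD using (module Bézout)
open import Data.Nat.Induction using (<-wellFounded)
open import Data.Nat.Primality using (prime⇒irreducible)
import Data.Nat.Properties as ℕ
open import Data.Product.Base using (Σ; ∃; _,_; proj₁; proj₂; uncurry)
import Data.Sign.Base as Sign
open import Data.Sum.Base using (_⊎_; inj₁; inj₂; [_,_]′)
open import Data.Unit.Base using (⊤; tt)
open import Data.Vec.Base using (Vec; []; _∷_; lookup; replicate; _[_]≔_)
open import Data.Vec.Properties using (lookup∘updateAt; lookup∘updateAt′; lookup-replicate)
open import Function.Base using (_∘_)
open import Induction.WellFounded using (Acc; acc)
open import Level using (0ℓ)
open import Relation.Binary.Definitions using (DecidableEquality)
import Relation.Binary.PropositionalEquality as ≡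
open import Relation.Nullary using (¬_; yes; no)

-- A ring solver with integer coefficients over any commutative ring.

module IntegerCoefficients {c ℓ} (R : CommutativeRing c ℓ) where
  open CommutativeRing R
  open import Algebra.Properties.Ring ring using (-0#≈0#; -‿involutive; -‿+-comm; -‿distribˡ-*; -‿distribʳ-*; xyx⁻¹≈y)
  open import Algebra.Properties.Semiring.Mult.TCOptimised semiring using (1+×; ×-homo-+; ×1-homo-*) renaming (_×_ to _·_)
  open import Algebra.Solver.Ring.AlmostCommutativeRing using (fromCommutativeRing; _-Raw-AlmostCommutative⟶_)
  open import Relation.Binary.Reasoning.Setoid setoid

  -- With the optimised multiple, `1 · 1#` reduces to `1#`, so the numeral 1 of the solver denotes
  -- `1#` by computation.
  fromℕ : ℕ → Carrier
  fromℕ n = n · 1#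

  fromℤ : ℤ.ℤ → Carrier
  fromℤ (ℤ.+ n)    = fromℕ n
  fromℤ ℤ.-[1+ n ] = - fromℕ (suc n)

  fromℤ-neg : ∀ i → fromℤ (ℤ.- i) ≈ - fromℤ i
  fromℤ-neg (ℤ.+ zero)    = sym -0#≈0#
  fromℤ-neg (ℤ.+ (suc n)) = refl
  fromℤ-neg ℤ.-[1+ n ]    = sym (-‿involutive _)

  fromℤ-⊖ : ∀ m n → fromℤ (m ℤ.⊖ n) ≈ fromℕ m - fromℕ n
  fromℤ-⊖ m       zero    = sym (trans (+-congˡ -0#≈0#) (+-identityʳ _))
  fromℤ-⊖ zero    (suc n) = sym (+-identityˡ _)
  fromℤ-⊖ (suc m) (suc n) = begin
    fromℤ (suc m ℤ.⊖ suc n)                ≡⟨ ≡.cong fromℤ (ℤ.[1+m]⊖[1+n]≡m⊖n m n) ⟩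
    fromℤ (m ℤ.⊖ n)                        ≈⟨ fromℤ-⊖ m n ⟩
    fromℕ m - fromℕ n                      ≈⟨ +-congʳ (xyx⁻¹≈y 1# (fromℕ m)) ⟨
    1# + fromℕ m - 1# - fromℕ n            ≈⟨ +-assoc _ _ _ ⟩
    1# + fromℕ m + (- 1# - fromℕ n)        ≈⟨ +-congˡ (-‿+-comm 1# (fromℕ n)) ⟩
    1# + fromℕ m - (1# + fromℕ n)          ≈⟨ +-cong (1+× m 1#) (-‿cong (1+× n 1#)) ⟨
    fromℕ (suc m) - fromℕ (suc n)          ∎

  fromℤ-+ : ∀ i j → fromℤ (i ℤ.+ j) ≈ fromℤ i + fromℤ j
  fromℤ-+ (ℤ.+ m)    (ℤ.+ n)    = ×-homo-+ 1# m n
  fromℤ-+ (ℤ.+ m)    ℤ.-[1+ n ] = fromℤ-⊖ m (suc n)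
  fromℤ-+ ℤ.-[1+ m ] (ℤ.+ n)    = trans (fromℤ-⊖ n (suc m)) (+-comm _ _)
  fromℤ-+ ℤ.-[1+ m ] ℤ.-[1+ n ] = begin
    - fromℕ (suc (suc (m ℕ.+ n)))          ≡⟨ ≡.cong (λ k → - fromℕ (suc k)) (ℕ.+-suc m n) ⟨
    - fromℕ (suc m ℕ.+ suc n)              ≈⟨ -‿cong (×-homo-+ 1# (suc m) (suc n)) ⟩
    - (fromℕ (suc m) + fromℕ (suc n))      ≈⟨ -‿+-comm _ _ ⟨
    - fromℕ (suc m) - fromℕ (suc n)        ∎

  fromℤ-+◃ : ∀ n → fromℤ (Sign.+ ℤ.◃ n) ≈ fromℕ n
  fromℤ-+◃ zero    = refl
  fromℤ-+◃ (suc n) = refl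

  fromℤ--◃ : ∀ n → fromℤ (Sign.- ℤ.◃ n) ≈ - fromℕ n
  fromℤ--◃ zero    = sym -0#≈0#
  fromℤ--◃ (suc n) = refl

  fromℤ-* : ∀ i j → fromℤ (i ℤ.* j) ≈ fromℤ i * fromℤ j
  fromℤ-* (ℤ.+ m)    (ℤ.+ n)    = trans (fromℤ-+◃ (m ℕ.* n)) (×1-homo-* m n)
  fromℤ-* (ℤ.+ m)    ℤ.-[1+ n ] = trans (fromℤ--◃ (m ℕ.* suc n))
    (trans (-‿cong (×1-homo-* m (suc n))) (-‿distribʳ-* _ _))
  fromℤ-* ℤ.-[1+ m ] (ℤ.+ n)    = trans (fromℤ--◃ (suc m ℕ.* n))
    (trans (-‿cong (×1-homo-* (suc m) n)) (-‿distribˡ-* _ _))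
  fromℤ-* ℤ.-[1+ m ] ℤ.-[1+ n ] = begin
    fromℕ (suc m ℕ.* suc n)                ≈⟨ ×1-homo-* (suc m) (suc n) ⟩
    fromℕ (suc m) * fromℕ (suc n)          ≈⟨ -‿involutive _ ⟨
    - (- (fromℕ (suc m) * fromℕ (suc n)))  ≈⟨ -‿cong (-‿distribʳ-* _ _) ⟩
    - (fromℕ (suc m) * - fromℕ (suc n))    ≈⟨ -‿distribˡ-* _ _ ⟩
    - fromℕ (suc m) * - fromℕ (suc n)      ∎

  morphism : ℤ.+-*-rawRing -Raw-AlmostCommutative⟶ fromCommutativeRing R
  morphism = record
    { ⟦_⟧    = fromℤ
    ; +-homo = fromℤ-+
    ; *-homo = fromℤ-*
    ; -‿homo = fromℤ-neg
    ; 0-homo = refl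
    ; 1-homo = refl
    }

  _fromℤ≟_ : ∀ i j → Maybe (fromℤ i ≈ fromℤ j)
  i fromℤ≟ j with i ℤ.≟ j
  ... | yes i≡j = just (reflexive (≡.cong fromℤ i≡j))
  ... | no  _   = nothing

  open import Algebra.Solver.Ring ℤ.+-*-rawRing (fromCommutativeRing R) morphism _fromℤ≟_ public
    using (solve; con; _:=_; _:+_; _:*_; _:-_; :-_; _:^_)

-- Polynomial identities for the differences and the cubic.

module CubicIdentities {c ℓ} (R : CommutativeRing c ℓ) where
  open CommutativeRing R
  open import Algebra.Properties.Semiring.Exp semiring using (_^_)
  open IntegerCoefficients R

  -- The two coordinates of a locked cop's difference when the robber plays a and
  -- the answer is − b.
  lock-shift : ∀ d n a b → d + (1# + n) * (a + b) ≈ d + (a - (- b)) + n * (a + b)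
  lock-shift = solve 4 (λ d n a b →
    d :+ (con (ℤ.+ 1) :+ n) :* (a :+ b) := d :+ (a :- (:- b)) :+ n :* (a :+ b)) refl

  lock-shift³ : ∀ d n a b → d + (1# + n) * (a ^ 3 + b ^ 3) ≈ d + (a ^ 3 - (- b) ^ 3) + n * (a ^ 3 + b ^ 3)
  lock-shift³ = solve 4 (λ d n a b →
    d :+ (con (ℤ.+ 1) :+ n) :* (a :^ 3 :+ b :^ 3)
      := d :+ (a :^ 3 :- (:- b) :^ 3) :+ n :* (a :^ 3 :+ b :^ 3)) refl

  -- The functional λ: the determinant of (v , w) and (d , e). Over a field with v ≠ 0 it vanishes
  -- exactly if (d , e) lies on the line spanned by (v , w).
  det : Carrier → Carrier → Carrier → Carrier → Carrier
  det v w d e = e * v - d * w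

  cubic : Carrier → Carrier → Carrier → Carrier
  cubic v w x = det v w x (x ^ 3)

  -- By linearity a round with moves x and y raises λ by δ, which uses up one unit of the budget 1 +
  -- n.
  det-shift : ∀ v w d e x y n δ → (cubic v w x - cubic v w y) ≈ δ →
    det v w (d + (x - y)) (e + (x ^ 3 - y ^ 3)) + n * δ ≈ det v w d e + (1# + n) * δ
  det-shift v w d e x y n δ eq =
    trans (+-congˡ (*-congˡ (sym eq))) (trans (identity v w d e x y n) (+-congˡ (*-congˡ eq)))
    where
    identity : ∀ v w d e x y n →
      det v w (d + (x - y)) (e + (x ^ 3 - y ^ 3)) + n * (cubic v w x - cubic v w y)
        ≈ det v w d e + (1# + n) * (cubic v w x - cubic v w y)
    identity = solve 7 (λ v w d e x y n →
      let D = λ d e → e :* v :- d :* w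
          Δ = D x (x :^ 3) :- D y (y :^ 3) in
      D (d :+ (x :- y)) (e :+ (x :^ 3 :- y :^ 3)) :+ n :* Δ
        := D d e :+ (con (ℤ.+ 1) :+ n) :* Δ) refl

  -- When the determinant and the first coordinate d + n v vanish, cancelling v makes the second
  -- coordinate vanish as well.
  det-line : ∀ v w d e n → v * (e + n * w) ≈ det v w d e + (d + n * v) * w
  det-line = solve 5 (λ v w d e n →
    v :* (e :+ n :* w) := (e :* v :- d :* w) :+ (d :+ n :* v) :* w) refl

  -- Oddness makes the effect of answering x by - y symmetric in x and y.
  cubic-odd : ∀ v w x y → cubic v w x - cubic v w (- y) ≈ cubic v w x + cubic v w y
  cubic-odd = solve 4 (λ v w x y →
    let f = λ x → x :^ 3 :* v :- x :* w in
    f x :- f (:- y) := f x :+ f y) refl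

  cubic-0 : ∀ v w → cubic v w 0# ≈ 0#
  cubic-0 = solve 2 (λ v w →
    let z = con (ℤ.+ 0) in z :^ 3 :* v :- z :* w := z) refl

  -- Shows that the cubic cannot vanish at both 1 and 2.
  cubic-1-2 : ∀ v w → cubic v w (1# + 1#) - (1# + 1#) * cubic v w 1# ≈ (1# + 1#) * ((1# + 1# + 1#) * v)
  cubic-1-2 = solve 2 (λ v w →
    let i = con (ℤ.+ 1) ; f = λ x → x :^ 3 :* v :- x :* w in
    f (i :+ i) :- (i :+ i) :* f i := (i :+ i) :* ((i :+ i :+ i) :* v)) refl

  -- If x is a root of e + x³ = (d + x)³, then the only other one is − d − x.
  cube-difference : ∀ d e x y →
    (e + x ^ 3 - (d + x) ^ 3) - (e + y ^ 3 - (d + y) ^ 3)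
      ≈ (1# + 1# + 1#) * (d * ((y - x) * (y - (- d - x))))
  cube-difference = solve 4 (λ d e x y →
    let i = con (ℤ.+ 1) in
    (e :+ x :^ 3 :- (d :+ x) :^ 3) :- (e :+ y :^ 3 :- (d :+ y) :^ 3)
      := (i :+ i :+ i) :* (d :* ((y :- x) :* (y :- (:- d :- x))))) refl

  cancel-step : ∀ u x → (u + x) - u ≈ x
  cancel-step = solve 2 (λ u x → (u :+ x) :- u := x) refl

  cancel-difference : ∀ u v → u + (v - u) ≈ v
  cancel-difference = solve 2 (λ u v → u :+ (v :- u) := v) refl

  difference-step : ∀ u x v → (u + x) - v ≈ (u - v) + x
  difference-step = solve 3 (λ u x v → (u :+ x) :- v := (u :- v) :+ x) refl

  -- Here d is the difference before the robber's last move x. The invariant d + x = r - c is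
  -- carried through the cop's answer y and the robber's next move x′.
  difference-round : ∀ {d x r c} y x′ → d + x ≈ r - c → (d + (x - y)) + x′ ≈ (r + x′) - (c + y)
  difference-round {d} {x} {r} {c} y x′ eq = trans (before d x y x′) (trans (+-congʳ eq) (after r c y x′))
    where
    before : ∀ d x y x′ → (d + (x - y)) + x′ ≈ (d + x) + (x′ - y)
    before = solve 4 (λ d x y x′ → (d :+ (x :- y)) :+ x′ := (d :+ x) :+ (x′ :- y)) refl
    after : ∀ r c y x′ → (r - c) + (x′ - y) ≈ (r + x′) - (c + y)
    after = solve 4 (λ r c y x′ → (r :- c) :+ (x′ :- y) := (r :+ x′) :- (c :+ y)) refl

  difference-zero : ∀ {x r c} → 0# + x ≈ r - c → c + x ≈ r
  difference-zero {x} {r} {c} eq =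
    trans (+-congˡ (trans (sym (+-identityˡ x)) eq)) (cancel-difference c r)

open ≡ using (_≡_; _≢_; refl; sym; trans; cong; cong₂; subst; module ≡-Reasoning)

-- Counting the free cops.

module _ {A : Set} where

  free : ∀ {k} → Vec (Maybe A) k → ℕ
  free []             = 0
  free (nothing ∷ st) = suc (free st)
  free (just _  ∷ st) = free st

  free-update : ∀ {k} (st : Vec (Maybe A) k) i a → lookup st i ≡ nothing →
                free st ≡ suc (free (st [ i ]≔ just a))
  free-update (nothing ∷ st) zero    a eq = refl
  free-update (nothing ∷ st) (suc i) a eq = cong suc (free-update st i a eq)
  free-update (just _  ∷ st) (suc i) a eq = free-update st i a eq

-- Distributing the robber's moves in good pairs among the free cops.

module Pairing
  {A : Set} (Good : A → A → Set)
  (default : A)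
  (partner : ∀ x → ∃ (Good x))
  (triple  : ∀ x y z → x ≢ y → x ≢ z → y ≢ z → Good x y ⊎ Good x z ⊎ Good y z)
  where

  -- The pair may contain moves outside `M`, so that lists too short to contain a good pair are
  -- served as well.
  record GoodPair (M : List A) (n : ℕ) : Set where
    field
      fst snd : A
      good    : Good fst snd
      rest    : List A
      unique  : Unique rest
      short   : length rest ≤ n
      covers  : ∀ {x} → x ∈ M → (x ≡ fst ⊎ x ≡ snd) ⊎ x ∈ rest

  -- Three moves contain a good pair but two may not. Hence c cops can promise only 2c - 1 moves,
  -- and each pair taken leaves this bound intact for c - 1 cops.
  goodPair : ∀ c M → Unique M → length M ≤ pred (c ℕ.* 2) → GoodPair M (pred (pred c ℕ.* 2))
  goodPair c [] u short = record
    { good   = proj₂ (partner default) ; unique = [] ; short = z≤n ; covers = λ () }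
  goodPair (suc c) (x ∷ []) u short = record
    { good   = proj₂ (partner x) ; unique = [] ; short = z≤n
    ; covers = λ { (here refl) → inj₁ (inj₁ refl) } }
  goodPair (suc zero) (x ∷ y ∷ M) u (s≤s ())
  -- The moves x and y may not fit together: x gets a partner of its own, and y is left to the
  -- second cop.
  goodPair (suc (suc c)) (x ∷ y ∷ []) (_ ∷ u) short = record
    { good   = proj₂ (partner x) ; unique = u ; short = s≤s z≤n
    ; covers = λ { (here refl) → inj₁ (inj₁ refl) ; (there y∈) → inj₂ y∈ } }
  goodPair (suc (suc c)) (x ∷ y ∷ z ∷ M) ((x≢y ∷ x≢z ∷ ux) ∷ (y≢z ∷ uy) ∷ uz ∷ u) (s≤s (s≤s short))
    with triple x y z x≢y x≢z y≢z
  ... | inj₁ xy = record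
    { good = xy ; unique = uz ∷ u ; short = short
    ; covers = λ { (here refl) → inj₁ (inj₁ refl) ; (there (here refl)) → inj₁ (inj₂ refl)
                 ; (there (there ∈M)) → inj₂ ∈M } }
  ... | inj₂ (inj₁ xz) = record
    { good = xz ; unique = uy ∷ u ; short = short
    ; covers = λ { (here refl) → inj₁ (inj₁ refl) ; (there (here refl)) → inj₂ (here refl)
                 ; (there (there (here refl))) → inj₁ (inj₂ refl)
                 ; (there (there (there ∈M))) → inj₂ (there ∈M) } }
  ... | inj₂ (inj₂ yz) = record
    { good = yz ; unique = ux ∷ u ; short = short
    ; covers = λ { (here refl) → inj₂ (here refl) ; (there (here refl)) → inj₁ (inj₁ refl)
                 ; (there (there (here refl))) → inj₁ (inj₂ refl)
                 ; (there (there (there ∈M))) → inj₂ (there ∈M) } }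

  -- Locked cops receive a dummy good pair, which keeps the functions total; only free cops count
  -- for `covers`.
  record Assignment {B : Set} {k} (st : Vec (Maybe B) k) (M : List A) : Set where
    field
      fst snd : Fin k → A
      good    : ∀ i → Good (fst i) (snd i)
      covers  : ∀ {x} → x ∈ M → ∃ λ i → lookup st i ≡ nothing × (x ≡ fst i ⊎ x ≡ snd i)

  assign : ∀ {B : Set} {k} (st : Vec (Maybe B) k) M → Unique M →
           length M ≤ pred (free st ℕ.* 2) → Assignment st M
  assign []            []  u short = record { fst = λ () ; snd = λ () ; good = λ () ; covers = λ () }
  assign (just b ∷ st) M   u short = record
    { fst    = λ { zero → default ; (suc i) → fst i }
    ; snd    = λ { zero → proj₁ (partner default) ; (suc i) → snd i }
    ; good   = λ { zero → proj₂ (partner default) ; (suc i) → good i }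
    ; covers = λ ∈M → let i , eq , s = covers ∈M in suc i , eq , s
    }
    where open Assignment (assign st M u short)
  assign {k = suc k} (nothing ∷ st) M u short = record
    { fst    = λ { zero → G.fst ; (suc i) → R.fst i }
    ; snd    = λ { zero → G.snd ; (suc i) → R.snd i }
    ; good   = λ { zero → G.good ; (suc i) → R.good i }
    ; covers = covers
    }
    where
    module G = GoodPair (goodPair (suc (free st)) M u short)
    module R = Assignment (assign st G.rest G.unique G.short)
    covers : ∀ {x} → x ∈ M → _
    covers ∈M with G.covers ∈M
    ... | inj₁ eq    = zero , refl , eq
    ... | inj₂ ∈rest = let i , eq , s = R.covers ∈rest in suc i , eq , s

-- Pursuit by budgets: finite strategy trees and a decreasing sum.

total : ∀ {k} → (Fin k → ℕ) → ℕ
total {zero}  n = 0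
total {suc k} n = n zero ℕ.+ total (n ∘ suc)

total-mono-≤ : ∀ {k} {m n : Fin k → ℕ} → (∀ j → m j ≤ n j) → total m ≤ total n
total-mono-≤ {zero}  m≤n = z≤n
total-mono-≤ {suc k} m≤n = ℕ.+-mono-≤ (m≤n zero) (total-mono-≤ (m≤n ∘ suc))

total-mono-< : ∀ {k} {m n : Fin k → ℕ} → (∀ j → m j ≤ n j) → ∀ i → m i < n i → total m < total n
total-mono-< m≤n zero    m<n = ℕ.+-mono-<-≤ m<n (total-mono-≤ (m≤n ∘ suc))
total-mono-< m≤n (suc i) m<n = ℕ.+-mono-≤-< (m≤n zero) (total-mono-< (m≤n ∘ suc) i m<n)

module Pursuit {D X : Set} (shift : D → X → X → D) (hold : ∀ d x → shift d x x ≡ d) where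

  -- A position lists the differences robber − cop; in each round the robber
  -- plays x and cop i answers y x i.
  data Reach {k : ℕ} (P : (Fin k → D) → Set) (d : Fin k → D) : Set where
    now   : P d → Reach P d
    round : (y : X → Fin k → X) → (∀ x → Reach P (λ i → shift (d i) x (y x i))) → Reach P d

  -- Continuing from every leaf strings the phases of the pursuit together.
  _>>=_ : ∀ {k} {P Q : (Fin k → D) → Set} {d} →
          Reach P d → (∀ {d} → P d → Reach Q d) → Reach Q d
  now p     >>= f = f p
  round y r >>= f = round y (λ x → r x >>= f)

  -- The duty of one cop: `Inv n d` says that n more answers to moves it serves bring it from d to
  -- its goal.
  record Task : Set₁ where
    field
      Inv     : ℕ → D → Set
      Serves  : X → Set
      advance : ∀ {n d x} → Inv (suc n) d → Serves x → ∃ λ y → Inv n (shift d x y)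
  open Task

  module _ {k} (T : Fin k → Task) (serve : ∀ x → ∃ λ i → Serves (T i) x) where

    -- The second component preserves what the other cops have achieved, in particular the locks,
    -- for the next phase.
    Finished : (Fin k → D) → Set
    Finished d = (∃ λ i → Inv (T i) 0 (d i)) × (∀ j → ∃ λ n → Inv (T j) n (d j))

    module Round (d : Fin k → D) (n : Fin k → ℕ) (inv : ∀ i → Inv (T i) (n i) (d i))
                 (busy : ¬ ∃ λ i → n i ≡ 0) where
      -- Only the cop chosen by `serve` spends budget. The others copy the robber, which by `hold`
      -- keeps their differences.
      answer : ∀ x j → ∃ λ y → ∃ λ m →
               Inv (T j) m (shift (d j) x y) × m ≤ n j × (j ≡ proj₁ (serve x) → m < n j)
      answer x j with j ≟ᶠ proj₁ (serve x)
      ... | no j≢i = x , n j , subst (Inv (T j) (n j)) (sym (hold (d j) x)) (inv j) , ℕ.≤-refl , λ eq → ⊥-elim (j≢i eq)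
      ... | yes refl with n j in eq | inv j
      ...   | zero  | _ = ⊥-elim (busy (j , eq))
      ...   | suc m | I = let y , I′ = advance (T j) I (proj₂ (serve x)) in
                          y , m , I′ , ℕ.n≤1+n m , λ _ → ℕ.≤-refl

    -- The sum of the budgets falls in every round, whatever the robber plays, so some budget
    -- reaches 0.
    runᴬ : ∀ d (n : Fin k → ℕ) → Acc _<_ (total n) → (∀ i → Inv (T i) (n i) (d i)) → Reach Finished d
    runᴬ d n (acc rec) inv with any? (λ i → n i ℕ.≟ 0)
    ... | yes (i , eq) = now ((i , subst (λ m → Inv (T i) m (d i)) eq (inv i)) , λ j → n j , inv j)
    ... | no  busy     = round (λ x j → proj₁ (answer x j)) λ x →
      runᴬ _ (λ j → proj₁ (proj₂ (answer x j)))
        (rec (total-mono-< (λ j → proj₁ (proj₂ (proj₂ (proj₂ (answer x j))))) (proj₁ (serve x))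
               (proj₂ (proj₂ (proj₂ (proj₂ (answer x (proj₁ (serve x)))))) refl)))
        (λ j → proj₁ (proj₂ (proj₂ (answer x j))))
      where open Round d n inv busy

    run : ∀ d → (∀ i → ∃ λ n → Inv (T i) n (d i)) → Reach Finished d
    run d inv = runᴬ d (proj₁ ∘ inv) (<-wellFounded _) (proj₂ ∘ inv)

-- The prime field: inverses and natural multiples.

module PrimeField (p : ℕ) .{{_ : NonZero p}} (p-prime : Prime p) (3<p : 3 < p) where
  open CommutativeRing (ℤ/ p ℤ) hiding (refl; sym; trans; zero) renaming (Carrier to F)
  open import Algebra.Properties.Ring ring using (+-inverseʳ-unique; -‿distribʳ-*; -‿involutive)
  open Residues p using (mod-+; mod-*; mod-toℕ; mod-cong; toℕ-mod)

  fromℕ : ℕ → F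
  fromℕ n = n mod p

  fromℕ-suc : ∀ n → fromℕ (suc n) ≡ 1# + fromℕ n
  fromℕ-suc n = sym (mod-+ 1 n)

  fromℕ≢0 : ∀ {n} → 0 < n → n < p → fromℕ n ≢ 0#
  fromℕ≢0 {n} 0<n n<p eq = ℕ.<⇒≢ 0<n (begin
    0            ≡⟨ m<n⇒m%n≡m (ℕ.<-trans 0<n n<p) ⟨
    0 % p        ≡⟨ toℕ-mod 0 ⟨
    toℕ (0 mod p) ≡⟨ cong toℕ eq ⟨
    toℕ (n mod p) ≡⟨ toℕ-mod n ⟩
    n % p        ≡⟨ m<n⇒m%n≡m n<p ⟩
    n            ∎)
    where open ≡-Reasoning

  1≢0 : 1# ≢ 0#
  1≢0 = fromℕ≢0 (s≤s z≤n) (ℕ.<-trans (s≤s (s≤s z≤n)) 3<p)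

  2≢0 : 1# + 1# ≢ 0#
  2≢0 eq = fromℕ≢0 (s≤s z≤n) (ℕ.<-trans (s≤s (s≤s (s≤s z≤n))) 3<p) (trans (sym (mod-+ 1 1)) eq)

  3≢0 : 1# + 1# + 1# ≢ 0#
  3≢0 eq = fromℕ≢0 (s≤s z≤n) 3<p (trans (sym (trans (cong (_+ 1#) (mod-+ 1 1)) (mod-+ 2 1))) eq)

  *-inverse : ∀ a → a ≢ 0# → ∃ λ b → a * b ≡ 1#
  *-inverse a a≢0 with coprime-Bézout (prime⇒coprime p-prime {{≢-nonZero toℕa≢0}} (toℕ<n a))
    where
    toℕa≢0 : toℕ a ≢ 0
    toℕa≢0 eq = a≢0 (trans (sym (mod-toℕ a)) (cong (_mod p) eq))
  ... | Bézout.-+ x y eq = fromℕ y , (begin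
    a * fromℕ y                    ≡⟨ cong (_* fromℕ y) (mod-toℕ a) ⟨
    fromℕ (toℕ a) * fromℕ y        ≡⟨ mod-* (toℕ a) y ⟩
    fromℕ (toℕ a ℕ.* y)            ≡⟨ cong fromℕ (ℕ.*-comm (toℕ a) y) ⟩
    fromℕ (y ℕ.* toℕ a)            ≡⟨ cong fromℕ eq ⟨
    fromℕ (1 ℕ.+ x ℕ.* p)          ≡⟨ mod-cong ([m+kn]%n≡m%n 1 x p) ⟩
    1#                             ∎)
    where open ≡-Reasoning
  -- In this case 1 + y a = x p, so a y = - 1 and the inverse of a is - y.
  ... | Bézout.+- x y eq = - fromℕ y , (begin
    a * - fromℕ y                  ≡⟨ -‿distribʳ-* a (fromℕ y) ⟨
    - (a * fromℕ y)                ≡⟨ cong -_ (+-inverseʳ-unique 1# (a * fromℕ y) 1+ay≡0) ⟩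
    - (- 1#)                       ≡⟨ -‿involutive 1# ⟩
    1#                             ∎)
    where
    open ≡-Reasoning
    1+ay≡0 : 1# + a * fromℕ y ≡ 0#
    1+ay≡0 = begin
      1# + a * fromℕ y                 ≡⟨ cong (λ z → 1# + z * fromℕ y) (mod-toℕ a) ⟨
      1# + fromℕ (toℕ a) * fromℕ y     ≡⟨ cong (1# +_) (mod-* (toℕ a) y) ⟩
      1# + fromℕ (toℕ a ℕ.* y)         ≡⟨ mod-+ 1 (toℕ a ℕ.* y) ⟩
      fromℕ (1 ℕ.+ toℕ a ℕ.* y)        ≡⟨ cong (λ z → fromℕ (1 ℕ.+ z)) (ℕ.*-comm (toℕ a) y) ⟩
      fromℕ (1 ℕ.+ y ℕ.* toℕ a)        ≡⟨ cong fromℕ eq ⟩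
      fromℕ (x ℕ.* p)                  ≡⟨ mod-cong (trans (m*n%n≡0 x p) (sym (m*n%n≡0 0 p))) ⟩
      0#                               ∎

  *-cancel-0 : ∀ {a b} → a ≢ 0# → a * b ≡ 0# → b ≡ 0#
  *-cancel-0 {a} {b} a≢0 ab≡0 with *-inverse a a≢0
  ... | c , ac≡1 = begin
    b              ≡⟨ *-identityˡ b ⟨
    1# * b         ≡⟨ cong (_* b) (trans (sym ac≡1) (*-comm a c)) ⟩
    c * a * b      ≡⟨ *-assoc c a b ⟩
    c * (a * b)    ≡⟨ cong (c *_) ab≡0 ⟩
    c * 0#         ≡⟨ zeroʳ c ⟩
    0#             ∎
    where open ≡-Reasoning

  -- The multiples of a nonzero δ exhaust the field, so every value t has a budget: the natural
  -- representative of - t / δ.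
  fromℕ-*-surjective : ∀ t {δ} → δ ≢ 0# → ∃ λ n → t + fromℕ n * δ ≡ 0#
  fromℕ-*-surjective t {δ} δ≢0 with *-inverse δ δ≢0
  ... | c , δc≡1 = toℕ (- t * c) , (begin
    t + fromℕ (toℕ (- t * c)) * δ  ≡⟨ cong (λ z → t + z * δ) (mod-toℕ (- t * c)) ⟩
    t + - t * c * δ                ≡⟨ cong (t +_) (*-assoc (- t) c δ) ⟩
    t + - t * (c * δ)              ≡⟨ cong (λ z → t + - t * z) (trans (*-comm c δ) δc≡1) ⟩
    t + - t * 1#                   ≡⟨ cong (t +_) (*-identityʳ (- t)) ⟩
    t - t                          ≡⟨ -‿inverseʳ t ⟩
    0#                             ∎)
    where open ≡-Reasoning

-- Capture, phase by phase, over a field known only through its laws.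

module CubicPursuit
  {F : Set} {_⊕_ _⊗_ : Op₂ F} {⊖_ : Op₁ F} {𝟘 𝟙 : F}
  (isCommutativeRing : IsCommutativeRing _≡_ _⊕_ _⊗_ ⊖_ 𝟘 𝟙)
  (_≟_ : DecidableEquality F)
  (1≢0 : 𝟙 ≢ 𝟘) (2≢0 : (𝟙 ⊕ 𝟙) ≢ 𝟘) (3≢0 : ((𝟙 ⊕ 𝟙) ⊕ 𝟙) ≢ 𝟘)
  (*-cancel-0 : ∀ {a b} → a ≢ 𝟘 → (a ⊗ b) ≡ 𝟘 → b ≡ 𝟘)
  (fromℕ : ℕ → F) (fromℕ-zero : fromℕ 0 ≡ 𝟘) (fromℕ-suc : ∀ n → fromℕ (suc n) ≡ (𝟙 ⊕ fromℕ n))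
  (fromℕ-*-surjective : ∀ t {δ} → δ ≢ 𝟘 → ∃ λ n → (t ⊕ (fromℕ n ⊗ δ)) ≡ 𝟘)
  where

  R : CommutativeRing 0ℓ 0ℓ
  R = record { isCommutativeRing = isCommutativeRing }

  open CommutativeRing R hiding (Carrier; refl; sym; trans; zero; isCommutativeRing)
  open import Algebra.Properties.Ring ring using (+-cancelˡ; x∙y⁻¹≈ε⇒x≈y)
  open import Algebra.Properties.Semiring.Exp semiring using (_^_)
  open CubicIdentities R

  G : Set
  G = F × F

  shift : G → F → F → G
  shift (d , e) x y = d + (x - y) , e + (x ^ 3 - y ^ 3)

  hold : ∀ d x → shift d x x ≡ d
  hold (d , e) x = cong₂ _,_ (cancel d x) (cancel e (x ^ 3))
    where
    cancel : ∀ d x → d + (x - x) ≡ d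
    cancel d x = trans (cong (d +_) (-‿inverseʳ x)) (+-identityʳ d)

  open Pursuit shift hold public

  Lock : F → F → ℕ → G → Set
  Lock a b n (d , e) = d + fromℕ n * (a + b) ≡ 0# × e + fromℕ n * (a ^ 3 + b ^ 3) ≡ 0#

  lock-swap : ∀ a b n d → Lock a b n d → Lock b a n d
  lock-swap a b n (d , e) (p₁ , p₂) =
    trans (cong (λ s → d + fromℕ n * s) (+-comm b a)) p₁ ,
    trans (cong (λ s → e + fromℕ n * s) (+-comm (b ^ 3) (a ^ 3))) p₂

  lock-advance : ∀ a b n d → Lock a b (suc n) d → Lock a b n (shift d a (- b))
  lock-advance a b n (d , e) (p₁ , p₂) =
    trans (sym (lock-shift d (fromℕ n) a b)) (trans (cong (λ m → d + m * (a + b)) (sym (fromℕ-suc n))) p₁) ,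
    trans (sym (lock-shift³ e (fromℕ n) a b)) (trans (cong (λ m → e + m * (a ^ 3 + b ^ 3)) (sym (fromℕ-suc n))) p₂)

  lock : F → F → Task
  lock a b = record
    { Inv     = Lock a b
    ; Serves  = λ x → x ≡ a ⊎ x ≡ b
    ; advance = λ { {n} {d} I (inj₁ refl) → - b , lock-advance a b n d I
                  ; {n} {d} I (inj₂ refl) →
                      - a , lock-swap b a n (shift d b (- a)) (lock-advance b a n d (lock-swap a b (suc n) d I)) }
    }

  -- (v , w) will be s a + s b for the moves a and b that the next cop is to be locked on; v ≠ 0
  -- then says that a and b are not opposite.
  module Target (v w : F) (v≢0 : v ≢ 0#) where
    f : F → F
    f = cubic v w

    -- Turns a finished alignment into a lock: n is chosen to solve the first coordinate, and the
    -- second follows by `det-line`.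
    line : ∀ d e → det v w d e ≡ 0# → ∃ λ n → d + fromℕ n * v ≡ 0# × e + fromℕ n * w ≡ 0#
    line d e det≡0 with fromℕ-*-surjective d v≢0
    ... | n , eq = n , eq , *-cancel-0 v≢0 (begin
      v * (e + fromℕ n * w)              ≡⟨ det-line v w d e (fromℕ n) ⟩
      det v w d e + (d + fromℕ n * v) * w ≡⟨ cong₂ (λ s t → s + t * w) det≡0 eq ⟩
      0# + 0# * w                        ≡⟨ trans (+-identityˡ _) (zeroˡ w) ⟩
      0#                                 ∎)
      where open ≡-Reasoning

    -- The value at 0 is 0, and vanishing at both 1 and 2 would force 6 v = 0, although 2, 3 and v
    -- are nonzero.
    f-nonconstant : ∀ u → ∃ λ y → f y ≢ u
    f-nonconstant u with u ≟ 0#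
    ... | no  u≢0  = 0# , λ eq → u≢0 (trans (sym eq) (cubic-0 v w))
    ... | yes refl with f 1# ≟ 0#
    ...   | no  f1≢0 = 1# , f1≢0
    ...   | yes f1≡0 = 1# + 1# , λ f2≡0 → v≢0 (*-cancel-0 3≢0 (*-cancel-0 2≢0 (begin
      (1# + 1#) * ((1# + 1# + 1#) * v)  ≡⟨ cubic-1-2 v w ⟨
      f (1# + 1#) - (1# + 1#) * f 1#    ≡⟨ cong₂ (λ s t → s - (1# + 1#) * t) f2≡0 f1≡0 ⟩
      0# - (1# + 1#) * 0#               ≡⟨ cong (λ s → 0# - s) (zeroʳ (1# + 1#)) ⟩
      0# - 0#                           ≡⟨ -‿inverseʳ 0# ⟩
      0#                                ∎)))
      where open ≡-Reasoning

    Alignable : F → F → Set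
    Alignable a b = ∃ λ δ → δ ≢ 0# × (∃ λ y → f a - f y ≡ δ) × (∃ λ y → f b - f y ≡ δ)

    alignable-≡ : ∀ a b → f a ≡ f b → Alignable a b
    alignable-≡ a b eq with f-nonconstant (f a)
    ... | y , fy≢fa = f a - f y , (λ z → fy≢fa (sym (x∙y⁻¹≈ε⇒x≈y _ _ z))) , (y , refl) , (y , cong (_- f y) (sym eq))

    alignable-+ : ∀ a b → f a + f b ≢ 0# → Alignable a b
    alignable-+ a b ≢0 = f a + f b , ≢0 , (- b , cubic-odd v w a b) , (- a , trans (cubic-odd v w b a) (+-comm (f b) (f a)))

    -- If f x cancels against both f y and f z, then f y = f z and the pair y, z has a common
    -- answer.
    alignable-triple : ∀ x y z → x ≢ y → x ≢ z → y ≢ z → Alignable x y ⊎ Alignable x z ⊎ Alignable y z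
    alignable-triple x y z _ _ _ with (f x + f y) ≟ 0#
    ... | no  xy = inj₁ (alignable-+ x y xy)
    ... | yes xy with (f x + f z) ≟ 0#
    ...   | no  xz = inj₂ (inj₁ (alignable-+ x z xz))
    ...   | yes xz = inj₂ (inj₂ (alignable-≡ y z (+-cancelˡ (f x) (f y) (f z) (trans xy (sym xz)))))

    open Pairing Alignable 0# (λ x → x , alignable-≡ x x refl) alignable-triple public

    -- The budget counts the steps δ from λ to 0. Both moves contribute the same δ, so it does not
    -- matter which of them the robber plays.
    align : ∀ a b → Alignable a b → Task
    align a b (δ , _ , (y₁ , eq₁) , (y₂ , eq₂)) = record
      { Inv     = λ n (d , e) → det v w d e + fromℕ n * δ ≡ 0#
      ; Serves  = λ x → x ≡ a ⊎ x ≡ b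
      ; advance = λ { {n} {d} I (inj₁ refl) → y₁ , advance n d y₁ eq₁ I
                    ; {n} {d} I (inj₂ refl) → y₂ , advance n d y₂ eq₂ I }
      }
      where
      advance : ∀ n d {x} y → f x - f y ≡ δ →
        det v w (proj₁ d) (proj₂ d) + fromℕ (suc n) * δ ≡ 0# →
        det v w (proj₁ (shift d x y)) (proj₂ (shift d x y)) + fromℕ n * δ ≡ 0#
      advance n (d , e) {x} y eq I = trans (det-shift v w d e x y (fromℕ n) δ eq)
        (trans (cong (λ m → det v w d e + m * δ) (sym (fromℕ-suc n))) I)

  NonOpposite : F → F → Set
  NonOpposite a b = a + b ≢ 0#

  nonOpposite-partner : ∀ a → ∃ (NonOpposite a)
  nonOpposite-partner a with a ≟ 0#
  ... | yes refl = 1# , λ eq → 1≢0 (trans (sym (+-identityˡ 1#)) eq)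
  ... | no  a≢0  = 0# , λ eq → a≢0 (trans (sym (+-identityʳ a)) eq)

  -- The opposite of x is unique, so it cannot be both y and z.
  nonOpposite-triple : ∀ x y z → x ≢ y → x ≢ z → y ≢ z → NonOpposite x y ⊎ NonOpposite x z ⊎ NonOpposite y z
  nonOpposite-triple x y z _ _ y≢z with (x + y) ≟ 0#
  ... | no  xy = inj₁ xy
  ... | yes xy = inj₂ (inj₁ (λ xz → y≢z (+-cancelˡ x y z (trans xy (sym xz)))))

  -- nothing stands for a free cop, just (a , b) for a cop locked on the moves a and b.
  Status : Set
  Status = Maybe (F × F)

  Locked : Status → G → Set
  Locked nothing        d = ⊤
  Locked (just (a , b)) d = ∃ λ n → Lock a b n d

  Blocks : Status → F → Set
  Blocks nothing        x = ⊥
  Blocks (just (a , b)) x = x ≡ a ⊎ x ≡ b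

  Captured : ∀ {k} → (Fin k → G) → Set
  Captured d = ∃ λ i → d i ≡ (0# , 0#)

  drop-zero : ∀ {d s} → d + fromℕ 0 * s ≡ 0# → d ≡ 0#
  drop-zero {d} {s} eq = trans (sym (begin
    d + fromℕ 0 * s  ≡⟨ cong (λ z → d + z * s) fromℕ-zero ⟩
    d + 0# * s       ≡⟨ cong (d +_) (zeroˡ s) ⟩
    d + 0#           ≡⟨ +-identityʳ d ⟩
    d                ∎)) eq
    where open ≡-Reasoning

  captured : ∀ a b d → Lock a b 0 d → d ≡ (0# , 0#)
  captured a b (d , e) (p₁ , p₂) = cong₂ _,_ (drop-zero p₁) (drop-zero p₂)

  module P = Pairing NonOpposite 0# nonOpposite-partner nonOpposite-triple

  -- The invariant between phases: locked cops take care of every move outside `open-moves`, and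
  -- with f free cops at most 2f - 1 moves are open, as `goodPair` and `assign` require.
  record Secured {k} (st : Vec Status k) (d : Fin k → G) : Set where
    field
      open-moves : List F
      unique     : Unique open-moves
      short      : length open-moves ≤ pred (free st ℕ.* 2)
      cover      : ∀ x → x ∈ open-moves ⊎ ∃ λ i → Blocks (lookup st i) x
      locked     : ∀ i → Locked (lookup st i) (d i)

  -- The open moves are paired twice: `next` picks by non-oppositeness the moves of the coming lock,
  -- and `assignment` divides all open moves among the free cops by alignability towards that lock.
  module Phase {k} {st : Vec Status k} {d} (secured : Secured st d)
    (next : P.GoodPair (Secured.open-moves secured) (pred (pred (free st) ℕ.* 2)))
    (assignment : Target.Assignment (P.GoodPair.fst next + P.GoodPair.snd next)
                    (P.GoodPair.fst next ^ 3 + P.GoodPair.snd next ^ 3) (P.GoodPair.good next)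
                    st (Secured.open-moves secured))
    where
    open Secured secured
    module N = P.GoodPair next
    open Target (N.fst + N.snd) (N.fst ^ 3 + N.snd ^ 3) N.good
    module S = Assignment assignment

    task : Status → Fin k → Task
    task nothing        i = align (S.fst i) (S.snd i) (S.good i)
    task (just (a , b)) i = lock a b

    T : Fin k → Task
    T i = task (lookup st i) i

    serve : ∀ x → ∃ λ i → Task.Serves (T i) x
    serve x with cover x
    ... | inj₁ x∈M = let i , eq , s = S.covers x∈M in i , subst (λ s → Task.Serves (task s i) x) (sym eq) s
    ... | inj₂ (i , blocks) = i , lemma (lookup st i) blocks
      where
      lemma : ∀ s → Blocks s x → Task.Serves (task s i) x
      lemma (just _) blocks = blocks

    start : ∀ i → ∃ λ n → Task.Inv (T i) n (d i)
    start i = lemma (lookup st i) (locked i)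
      where
      lemma : ∀ s → Locked s (d i) → ∃ λ n → Task.Inv (task s i) n (d i)
      lemma nothing  _ = fromℕ-*-surjective _ (proj₁ (proj₂ (S.good i)))
      lemma (just _) l = l

    -- A locked cop with budget 0 has caught the robber. A free one has λ = 0, so it becomes locked
    -- on the target pair, whose moves leave the open list.
    finish : (∀ {st′ d′} → free st ≡ suc (free st′) → Secured st′ d′ → Reach Captured d′) →
             ∀ {d} → Finished T serve d → Reach Captured d
    finish continue {d} ((i , I) , all) = lemma (lookup st i) refl I
      where
      lemma : ∀ s → lookup st i ≡ s → Task.Inv (task s i) 0 (d i) → Reach Captured d
      lemma (just (a , b)) eq I = now (i , captured a b (d i) I)
      lemma nothing eq I = continue {st′} free-st record
        { open-moves = N.rest
        ; unique     = N.unique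
        ; short      = subst (λ c → length N.rest ≤ pred (pred c ℕ.* 2)) free-st N.short
        ; cover      = cover′
        ; locked     = locked′
        }
        where
        st′ : Vec Status k
        st′ = st [ i ]≔ just (N.fst , N.snd)
        free-st : free st ≡ suc (free st′)
        free-st = free-update st i (N.fst , N.snd) eq
        here′ : lookup st′ i ≡ just (N.fst , N.snd)
        here′ = lookup∘updateAt i st
        cover′ : ∀ x → x ∈ N.rest ⊎ ∃ λ j → Blocks (lookup st′ j) x
        cover′ x with cover x
        ... | inj₁ x∈M with N.covers x∈M
        ...   | inj₁ s  = inj₂ (i , subst (λ s → Blocks s x) (sym here′) s)
        ...   | inj₂ x∈ = inj₁ x∈
        cover′ x | inj₂ (j , blocks) with j ≟ᶠ i
        -- Cop i was free and blocked nothing, so its change of status releases no move.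
        ...   | yes refl = ⊥-elim (subst (λ s → Blocks s x) eq blocks)
        ...   | no  j≢i  = inj₂ (j , subst (λ s → Blocks s x) (sym (lookup∘updateAt′ j i j≢i st)) blocks)
        -- Alignments of the other free cops refer to the old target and are dropped; locks persist.
        weaken : ∀ s j → (∃ λ n → Task.Inv (task s j) n (d j)) → Locked s (d j)
        weaken nothing  j _ = tt
        weaken (just _) j l = l
        locked′ : ∀ j → Locked (lookup st′ j) (d j)
        locked′ j with j ≟ᶠ i
        ... | no j≢i  = subst (λ s → Locked s (d j)) (sym (lookup∘updateAt′ j i j≢i st)) (weaken (lookup st j) j (all j))
        ... | yes refl = subst (λ s → Locked s (d i)) (sym here′)
          (line _ _ (drop-zero I))

  secure-next : ∀ {k} {st : Vec Status k} {d} → Secured st d →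
    (∀ {st′ d′} → free st ≡ suc (free st′) → Secured st′ d′ → Reach Captured d′) → Reach Captured d
  secure-next {st = st} {d} secured continue = run T serve d start >>= finish continue
    where
    open Secured secured
    next : P.GoodPair open-moves (pred (pred (free st) ℕ.* 2))
    -- With no cop free the open list is empty and this pair is a dummy: the phase can only end in a
    -- capture.
    next = P.goodPair (free st) open-moves unique short
    open Phase secured next (Target.assign _ _ (P.GoodPair.good next) st open-moves unique short)

  capture : ∀ {k} {st : Vec Status k} {d} → Acc _<_ (free st) → Secured st d → Reach Captured d
  capture (acc rec) s = secure-next s λ eq → capture (rec (ℕ.≤-reflexive (sym eq)))

  free-replicate : ∀ k → free (replicate k (nothing {A = F × F})) ≡ k
  free-replicate zero    = refl
  free-replicate (suc k) = cong suc (free-replicate k)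

  capture-from-anywhere : ∀ {k} (moves : List F) → Unique moves → (∀ x → x ∈ moves) →
                          length moves < k ℕ.* 2 → (d : Fin k → G) → Reach Captured d
  capture-from-anywhere {k} moves unique complete length<2k d =
    capture {st = replicate k nothing} (<-wellFounded _) record
    { open-moves = moves
    ; unique     = unique
    ; short      = subst (λ c → length moves ≤ pred (c ℕ.* 2)) (sym (free-replicate k)) (ℕ.pred-mono-≤ length<2k)
    ; cover      = λ x → inj₁ (complete x)
    ; locked     = λ i → subst (λ s → Locked s (d i)) (sym (lookup-replicate i nothing)) tt
    }

not-surjective : ∀ {m n} → m < n → (g : Fin m → Fin n) → ∃ λ x → ∀ j → g j ≢ x
not-surjective {m} {n} m<n g =
  let x , missed = ¬∀⟶∃¬ n (λ x → ∃ λ j → g j ≡ x) (λ x → any? (λ j → g j ≟ᶠ x)) ¬surjective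
  in x , λ j eq → missed (j , eq)
  where
  ¬surjective : ¬ (∀ x → ∃ λ j → g j ≡ x)
  ¬surjective surj with pigeonhole m<n (proj₁ ∘ surj)
  ... | x , y , x<y , eq = <⇒≢ᶠ x<y (trans (sym (proj₂ (surj x))) (trans (cong g eq) (proj₂ (surj y))))

-- The game on the Cayley graph.

module CubicGame (p : ℕ) .{{_ : NonZero p}} (p-prime : Prime p) (3<p : 3 < p) where
  open CommutativeRing (ℤ/ p ℤ) hiding (refl; sym; trans; zero; _≈_) renaming (Carrier to F)
  open import Algebra.Properties.Ring ring using (x∙y⁻¹≈ε⇒x≈y; x≈y⇒x∙y⁻¹≈ε)
  open import Algebra.Properties.Semiring.Exp semiring using (_^_)
  open PrimeField p p-prime 3<p
  open CubicIdentities (ℤ/ p ℤ)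
  open CubicPursuit isCommutativeRing _≟ᶠ_ 1≢0 2≢0 3≢0 *-cancel-0 fromℕ refl fromℕ-suc fromℕ-*-surjective
    using (G; Reach; now; round; Captured; capture-from-anywhere)
  open Graph (CubicCayleyGraph p) using (Step)
  open CopsAndRobbers (CubicCayleyGraph p) hiding (CopNumberIs)

  step : G → F → G
  step (u , v) x = u + x , v + x ^ 3

  step-legal : ∀ u x → Step u (step u x)
  step-legal (u , v) x = inj₁ (x , cancel-step u x , cancel-step v (x ^ 3))

  0^3 : 0# ^ 3 ≡ 0#
  0^3 = zeroˡ _

  step-0 : ∀ u → step u 0# ≡ u
  step-0 (u , v) = cong₂ _,_ (+-identityʳ u) (trans (cong (v +_) 0^3) (+-identityʳ v))

  stepped-by : G → G → F
  stepped-by (u , _) (u′ , _) = u′ - u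

  -- Staying put is the move 0, as 0³ = 0. So every legal step adds some s x, with x read off the
  -- first coordinate.
  step-complete : ∀ u v → Step u v → v ≡ step u (stepped-by u v)
  step-complete (u₁ , u₂) (v₁ , v₂) (inj₁ (x , refl , eq)) =
    cong₂ _,_ (sym (cancel-difference u₁ v₁)) (trans (sym (cancel-difference u₂ v₂)) (cong (u₂ +_) eq))
  step-complete (u₁ , u₂) (v₁ , v₂) (inj₂ (refl , refl)) =
    cong₂ _,_ (sym (cancel-difference u₁ u₁))
      (sym (trans (cong (λ z → u₂ + z ^ 3) (-‿inverseʳ u₁)) (trans (cong (u₂ +_) 0^3) (+-identityʳ u₂))))

  difference : G → G → G
  difference (r₁ , r₂) (c₁ , c₂) = r₁ - c₁ , r₂ - c₂

  -- Upper bound: the cops follow a strategy tree.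

  module Cops {k} (p<2k : p < k ℕ.* 2) where

    Memory : Set
    Memory = Σ (Fin k → G) (Reach Captured)

    answer : Memory → F → Fin k → F
    -- At a leaf some difference is 0, so that cop catches the robber by copying its last move.
    answer (d , now _)     x i = x
    answer (d , round y _) x i = y x i

    update : Memory → F → Memory
    update m@(d , now _)   x = m
    update (d , round y r) x = _ , r x

    winnable : (d : Fin k → G) → Reach Captured d
    winnable = capture-from-anywhere (allFin p) (allFin⁺ p) ∈-allFin
      (subst (_< k ℕ.* 2) (sym (length-tabulate _)) p<2k)

    -- The memory before the robber's last move, and that move.
    recall : Placement k × G → List (Placement k × G) → Memory × F
    -- The first cop turn is preceded by a fictitious robber move 0.
    recall (C , r) []             = ((λ i → difference r (C i)) , winnable _) , 0#
    recall (C , r) ((C′ , r′) ∷ h) = update (proj₁ m) (proj₂ m) , stepped-by r′ r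
      where m = recall (C′ , r′) h

    recall⁺ : History k → Memory × F
    recall⁺ h = recall (head h) (tail h)

    strategy : CopStrategy k
    strategy = record
      { start = λ _ → 0# , 0#
      ; move  = λ h i → step (proj₁ (head h) i) (answer (proj₁ (recall⁺ h)) (proj₂ (recall⁺ h)) i)
      ; legal = λ h i → step-legal _ _
      }

    module _ (ρ : RobberPlay) where
      open RobberPlay ρ

      cops : ℕ → Placement k
      cops n = proj₁ (head (history strategy ρ n))

      robber-head : ∀ n → proj₂ (head (history strategy ρ n)) ≡ position n
      robber-head zero    = refl
      robber-head (suc n) = refl

      -- The tree speaks of differences before a robber move, while cops act after it; the pending
      -- move x accounts for the gap.
      Tracks : (Fin k → G) → F → ℕ → Set
      Tracks d x n = ∀ i → step (d i) x ≡ difference (position n) (cops n i)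

      captures : ∀ {d} (t : Reach Captured d) x n →
                 recall⁺ (history strategy ρ n) ≡ ((d , t) , x) → Tracks d x n →
                 ∃ λ n → CapturedAt strategy ρ n
      captures {d} (now (i , di≡0)) x n eq tracks = n , inj₂ (i , cong proj₁ caught , cong proj₂ caught)
        where
        catch : ∀ c r → step (0# , 0#) x ≡ difference r c → step c x ≡ r
        catch c r eq = cong₂ _,_ (difference-zero (cong proj₁ eq)) (difference-zero (cong proj₂ eq))
        caught : CopStrategy.move strategy (history strategy ρ n) i ≡ proj₂ (head (history strategy ρ n))
        caught = begin
          step (cops n i) (answer (proj₁ (recall⁺ (history strategy ρ n))) (proj₂ (recall⁺ (history strategy ρ n))) i)
            ≡⟨ cong (λ m → step (cops n i) (answer (proj₁ m) (proj₂ m) i)) eq ⟩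
          step (cops n i) x
            ≡⟨ catch (cops n i) (position n) (trans (cong (λ z → step z x) (sym di≡0)) (tracks i)) ⟩
          position n
            ≡⟨ robber-head n ⟨
          proj₂ (head (history strategy ρ n)) ∎
          where open ≡-Reasoning
      captures {d} (round y t) x n eq tracks = captures (t x) x′ (suc n) recall-suc tracks-suc
        where
        x′ : F
        x′ = stepped-by (position n) (position (suc n))
        recall-suc : recall⁺ (history strategy ρ (suc n)) ≡ ((_ , t x) , x′)
        recall-suc = cong₂ _,_ (cong (λ m → update (proj₁ m) (proj₂ m)) eq)
                               (cong (λ r → stepped-by r (position (suc n))) (robber-head n))
        follow : ∀ e r r′ c y → step e x ≡ difference r c → r′ ≡ step r x′ →
          step (proj₁ e + (x - y) , proj₂ e + (x ^ 3 - y ^ 3)) x′ ≡ difference r′ (step c y)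
        follow e r _ c y eq refl = cong₂ _,_
          (difference-round y x′ (cong proj₁ eq)) (difference-round (y ^ 3) (x′ ^ 3) (cong proj₂ eq))
        tracks-suc : Tracks _ x′ (suc n)
        tracks-suc i = trans
          (follow (d i) (position n) (position (suc n)) (cops n i) (y x i) (tracks i)
            (step-complete (position n) (position (suc n)) (legal n)))
          (cong (λ m → difference (position (suc n)) (step (cops n i) (answer (proj₁ m) (proj₂ m) i))) (sym eq))

    winning : Winning strategy
    winning ρ = captures ρ (winnable _) 0# 0 refl λ i →
      step-0 (difference (RobberPlay.position ρ 0) (CopStrategy.start strategy i))

  -- Lower bound: the robber stays out of reach.

  Blocked : G → F → Set
  Blocked (d , e) x = e + x ^ 3 ≡ (d + x) ^ 3

  blocked : ∀ c r x → Step c (step r x) → Blocked (difference r c) x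
  blocked c@(c₁ , c₂) r@(r₁ , r₂) x s = begin
    (r₂ - c₂) + x ^ 3              ≡⟨ difference-step r₂ (x ^ 3) c₂ ⟨
    (r₂ + x ^ 3) - c₂              ≡⟨ cong (_- c₂) (cong proj₂ (step-complete c (step r x) s)) ⟩
    (c₂ + ((r₁ + x) - c₁) ^ 3) - c₂ ≡⟨ cancel-step c₂ _ ⟩
    ((r₁ + x) - c₁) ^ 3            ≡⟨ cong (_^ 3) (difference-step r₁ x c₁) ⟩
    ((r₁ - c₁) + x) ^ 3            ∎
    where open ≡-Reasoning

  difference≢0 : ∀ r c → c ≢ r → difference r c ≢ (0# , 0#)
  difference≢0 r c c≢r eq = c≢r (sym (cong₂ _,_ (x∙y⁻¹≈ε⇒x≈y _ _ (cong proj₁ eq)) (x∙y⁻¹≈ε⇒x≈y _ _ (cong proj₂ eq))))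

  -- If the first coordinate is 0, the equation says that the second is 0 too. Otherwise a known
  -- root u leaves - d - u as the only other candidate, by `cube-difference`.
  blocks-two : ∀ d → d ≢ (0# , 0#) → ∃ λ u → ∃ λ v → ∀ x → Blocked d x → x ≡ u ⊎ x ≡ v
  blocks-two (d , e) d≢0 with any? (λ x → (e + x ^ 3) ≟ᶠ ((d + x) ^ 3))
  ... | no  none    = 0# , 0# , λ x b → ⊥-elim (none (x , b))
  ... | yes (u , b) with d ≟ᶠ 0#
  ...   | yes refl = ⊥-elim (d≢0 (cong (0# ,_) e≡0))
    where
    e≡0 : e ≡ 0#
    e≡0 = begin
      e                          ≡⟨ cancel-step (u ^ 3) e ⟨
      (u ^ 3 + e) - u ^ 3        ≡⟨ cong (_- u ^ 3) (trans (+-comm (u ^ 3) e) b) ⟩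
      (0# + u) ^ 3 - u ^ 3       ≡⟨ cong (λ z → z ^ 3 - u ^ 3) (+-identityˡ u) ⟩
      u ^ 3 - u ^ 3              ≡⟨ -‿inverseʳ (u ^ 3) ⟩
      0#                         ∎
      where open ≡-Reasoning
  ...   | no  d≢0 = u , - d - u , other
    where
    other : ∀ x → Blocked (d , e) x → x ≡ u ⊎ x ≡ - d - u
    other x b′ with x ≟ᶠ u
    ... | yes x≡u = inj₁ x≡u
    ... | no  x≢u = inj₂ (x∙y⁻¹≈ε⇒x≈y _ _ (*-cancel-0 (λ z → x≢u (x∙y⁻¹≈ε⇒x≈y _ _ z)) (*-cancel-0 d≢0 (*-cancel-0 3≢0 (begin
      (1# + 1# + 1#) * (d * ((x - u) * (x - (- d - u))))     ≡⟨ cube-difference d e u x ⟨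
      (e + u ^ 3 - (d + u) ^ 3) - (e + x ^ 3 - (d + x) ^ 3)  ≡⟨ cong₂ _-_ (x≈y⇒x∙y⁻¹≈ε b) (x≈y⇒x∙y⁻¹≈ε b′) ⟩
      0# - 0#                                                ≡⟨ -‿inverseʳ 0# ⟩
      0#                                                     ∎)))))
      where open ≡-Reasoning

  module Robber {k} (k+k<p : k ℕ.+ k < p) where

    -- The k cops block at most 2k < p moves, so some move remains.
    escape : ∀ (C : Placement k) r → (∀ i → C i ≢ r) → ∃ λ x → ∀ i → ¬ Step (C i) (step r x)
    escape C r C≢r = x , unblocked
      where
      two : ∀ i → ∃ λ u → ∃ λ v → ∀ x → Blocked (difference r (C i)) x → x ≡ u ⊎ x ≡ v
      two i = blocks-two (difference r (C i)) (difference≢0 r (C i) (C≢r i))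
      u v : Fin k → F
      u i = proj₁ (two i)
      v i = proj₁ (proj₂ (two i))
      unhit : ∃ λ x → ∀ j → [ u , v ]′ (splitAt k j) ≢ x
      unhit = not-surjective k+k<p ([ u , v ]′ ∘ splitAt k)
      x : F
      x = proj₁ unhit
      impossible : ∀ i → ¬ (x ≡ u i ⊎ x ≡ v i)
      impossible i (inj₁ x≡u) = proj₂ unhit (i ↑ˡ k) (trans (cong [ u , v ]′ (splitAt-↑ˡ k i k)) (sym x≡u))
      impossible i (inj₂ x≡v) = proj₂ unhit (k ↑ʳ i) (trans (cong [ u , v ]′ (splitAt-↑ʳ k k i)) (sym x≡v))
      unblocked : ∀ i → ¬ Step (C i) (step r x)
      unblocked i s = impossible i (proj₂ (proj₂ (two i)) x (blocked (C i) r x s))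

    module _ (σ : CopStrategy k) where
      open CopStrategy σ

      SafeHistory : Set
      SafeHistory = Σ (History k) λ h → ∀ i → ¬ Step (proj₁ (head h) i) (proj₂ (head h))

      start-vertex : ∃ λ r → ∀ i → start i ≢ r
      start-vertex with not-surjective (ℕ.≤-<-trans (ℕ.m≤m+n k k) k+k<p) (proj₁ ∘ start)
      ... | x , missed = (x , 0#) , λ i eq → missed i (cong proj₁ eq)

      safe-start : SafeHistory
      -- A vertex without a cop may still be within reach of one, so the robber starts one escaping
      -- move away from it.
      safe-start = let x , safe = escape start _ (proj₂ start-vertex) in
        [ start , step (proj₁ start-vertex) x ] , safe

      evade : ((h , _) : SafeHistory) → ∃ λ x → ∀ i → ¬ Step (move h i) (step (proj₂ (head h)) x)
      -- The robber was out of reach, so no cop has just landed on it and `escape` applies again.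
      evade (h , safe) = escape (move h) (proj₂ (head h)) λ i eq → safe i (subst (Step _) eq (legal h i))

      safe : ℕ → SafeHistory
      safe zero    = safe-start
      safe (suc n) = (move h , step (proj₂ (head h)) (proj₁ (evade s))) ∷⁺ h , proj₂ (evade s)
        where
        s = safe n
        h = proj₁ s

      evasion : RobberPlay
      evasion = record
        { position = λ n → proj₂ (head (proj₁ (safe n)))
        ; legal    = λ n → step-legal _ _
        }

      -- The evasion is built together with a history of its own, which must be identified with the
      -- one the game records.
      evasion-history : ∀ n → history σ evasion n ≡ proj₁ (safe n)
      evasion-history zero    = refl
      evasion-history (suc n) = cong (λ h → (move h , RobberPlay.position evasion (suc n)) ∷⁺ h) (evasion-history n)

      Caught : History k → Set
      Caught h = Catches (proj₁ (head h)) (proj₂ (head h)) ⊎ Catches (move h) (proj₂ (head h))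

      uncaught : ((h , _) : SafeHistory) → ¬ Caught h
      uncaught (h , safe) (inj₁ (i , eq))        = safe i (inj₂ eq)
      uncaught (h , safe) (inj₂ (i , eq₁ , eq₂)) = safe i (subst (Step _) (cong₂ _,_ eq₁ eq₂) (legal h i))

      evasion-safe : ∀ n → ¬ CapturedAt σ evasion n
      evasion-safe n caught = uncaught (safe n) (subst Caught (evasion-history n) caught)

    cops-lose : ¬ CopsWin k
    cops-lose (σ , wins) = let n , captured = wins (evasion σ) in evasion-safe σ n captured

-- Halves rounded up, and the order of the group.

n≤⌈n/2⌉*2 : ∀ n → n ≤ ⌈ n /2⌉ ℕ.* 2
n≤⌈n/2⌉*2 n = begin
  n                        ≡⟨ ℕ.⌊n/2⌋+⌈n/2⌉≡n n ⟨
  ⌊ n /2⌋ ℕ.+ ⌈ n /2⌉      ≤⟨ ℕ.+-monoˡ-≤ ⌈ n /2⌉ (ℕ.⌊n/2⌋≤⌈n/2⌉ n) ⟩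
  ⌈ n /2⌉ ℕ.+ ⌈ n /2⌉      ≡⟨ cong (⌈ n /2⌉ ℕ.+_) (ℕ.+-identityʳ ⌈ n /2⌉) ⟨
  2 ℕ.* ⌈ n /2⌉            ≡⟨ ℕ.*-comm 2 ⌈ n /2⌉ ⟩
  ⌈ n /2⌉ ℕ.* 2            ∎
  where open ℕ.≤-Reasoning

k<⌈n/2⌉⇒k+k<n : ∀ {k n} → k < ⌈ n /2⌉ → k ℕ.+ k < n
k<⌈n/2⌉⇒k+k<n {k} {n} k<⌈n/2⌉ = begin-strict
  -- Since k + 1 ≤ ⌈ n /2⌉ ≤ ⌊ n /2⌋ + 1, the first summand is at most ⌊ n /2⌋.
  k ℕ.+ k                  <⟨ ℕ.+-mono-≤-< (ℕ.≤-pred (ℕ.≤-trans k<⌈n/2⌉ (ℕ.⌊n/2⌋-mono (ℕ.n≤1+n _)))) k<⌈n/2⌉ ⟩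
  ⌊ n /2⌋ ℕ.+ ⌈ n /2⌉      ≡⟨ ℕ.⌊n/2⌋+⌈n/2⌉≡n n ⟩
  n                        ∎
  where open ℕ.≤-Reasoning

-- Strictness, from p being odd, matters because k cops manage only 2k - 1 moves.
p<⌈p/2⌉*2 : ∀ {p} → Prime p → 3 < p → p < ⌈ p /2⌉ ℕ.* 2
p<⌈p/2⌉*2 {p} p-prime 3<p = ℕ.≤∧≢⇒< (n≤⌈n/2⌉*2 p) odd
  where
  odd : p ≢ ⌈ p /2⌉ ℕ.* 2
  odd eq with prime⇒irreducible p-prime (divides ⌈ p /2⌉ eq)
  ... | inj₁ ()
  ... | inj₂ refl = ℕ.<⇒≱ 3<p (s≤s (s≤s z≤n))

ℤ/pℤ²-order : ∀ p .{{_ : NonZero p}} → HasOrder (ℤ/pℤ² p) (p ℕ.* p)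
ℤ/pℤ²-order p = record
  { to        = uncurry combine
  ; from      = remQuot p
  ; to-cong   = λ { (refl , refl) → refl }
  ; from-cong = λ { refl → refl , refl }
  ; inverse   = (λ { {x} (eq₁ , eq₂) → trans (cong₂ combine eq₁ eq₂) (combine-remQuot {p} p x) })
              , (λ { {u , v} refl → cong proj₁ (remQuot-combine {p} {p} u v) , cong proj₂ (remQuot-combine {p} {p} u v) })
  }

m^2≡m*m : ∀ m → m ℕ.^ 2 ≡ m ℕ.* m
m^2≡m*m m = cong (m ℕ.*_) (ℕ.*-identityʳ m)

⌈p/2⌉-isCeilHalfSqrt : ∀ p → IsCeilHalfSqrt (p ℕ.* p) ⌈ p /2⌉
⌈p/2⌉-isCeilHalfSqrt p = upper , least
  where
  upper : p ℕ.* p ≤ (2 ℕ.* ⌈ p /2⌉) ℕ.^ 2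
  upper = subst (p ℕ.* p ≤_) (sym (m^2≡m*m (2 ℕ.* ⌈ p /2⌉))) (ℕ.*-mono-≤ p≤2m p≤2m)
    where p≤2m = ℕ.≤-trans (n≤⌈n/2⌉*2 p) (ℕ.≤-reflexive (ℕ.*-comm ⌈ p /2⌉ 2))
  least : ∀ k → p ℕ.* p ≤ (2 ℕ.* k) ℕ.^ 2 → ⌈ p /2⌉ ≤ k
  least k p²≤ = ℕ.≮⇒≥ λ k<⌈p/2⌉ →
    let 2k<p = subst (_< p) (cong (k ℕ.+_) (sym (ℕ.+-identityʳ k))) (k<⌈n/2⌉⇒k+k<n k<⌈p/2⌉)
    in ℕ.<⇒≱ (ℕ.*-mono-< 2k<p 2k<p) (subst (p ℕ.* p ≤_) (m^2≡m*m (2 ℕ.* k)) p²≤)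

theorem5p1 : (p : ℕ) (p-prime : Prime p) → 3 < p →
    CopNumberIs (CubicCayleyGraph p {{prime⇒nonZero p-prime}}) ⌈ p /2⌉
    × (∃[ N ] (HasOrder (ℤ/pℤ² p {{prime⇒nonZero p-prime}}) N × IsCeilHalfSqrt N ⌈ p /2⌉))
theorem5p1 p p-prime 3<p =
  ( (Cops.strategy p<2m , Cops.winning p<2m)
  , λ k cops-win → ℕ.≮⇒≥ λ k<m → Robber.cops-lose (k<⌈n/2⌉⇒k+k<n k<m) cops-win )
  , p ℕ.* p , ℤ/pℤ²-order p {{prime⇒nonZero p-prime}} , ⌈p/2⌉-isCeilHalfSqrt p
  where
  open CubicGame p {{prime⇒nonZero p-prime}} p-prime 3<p
  p<2m : p < ⌈ p /2⌉ ℕ.* 2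
  p<2m = p<⌈p/2⌉*2 p-prime 3<p
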